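{- Assume that $n \geq k + 2$, $|A| = k$, and $f \colon A^n \to B$ is determined by $(\operatorname{pr}, \operatorname{supp})$. Then $f$ is reconstructible.
   Context: $A$ and $B$ are sets with at least two elements; $k$, $n$ are positive integers. $[n] := \{1,\dots,n\}$, $\binom{[n]}{2}$ denotes the set of all $2$-element subsets of $[n]$, and $\Sigma_n$ is the symmetric group on $[n]$. For $\mathbf{a} \in A^n$ and $\sigma \colon [m] \to [n]$, write $\mathbf{a}\sigma := (a_{\sigma(1)},\dots,a_{\sigma(m)}) \in A^m$. Functions $f, g \colon A^n \to B$ are equivalent, $f \equiv g$, if there is $\sigma \in \Sigma_n$ with $f(\mathbf{a}) = g(\mathbf{a}\sigma)$ for all $\mathbf{a} \in A^n$. For $n \geq 2$, $f \colon A^n \to B$ and $I \in \binom{[n]}{2}$, the identification minor $f_I \colon A^{n-1} \to B$ is given by $f_I(\mathbf{a}) = f(\mathbf{a}\delta_I)$, where $\delta_I \colon [n] \to [n-1]$ is defined by $\delta_I(i) = i$ if $i < \max I$, $\delta_I(i) = \min I$ if $i = \max I$, and $\delta_I(i) = i-1$ if $i > \max I$. The deck of $f$, $\operatorname{deck} f$, is the multiset $\{f_I/{\equiv} : I \in \binom{[n]}{2}\}$ of equivalence classes. A function $g \colon A^n \to B$ is a reconstruction of $f$ if $\operatorname{deck} f = \operatorname{deck} g$. The function $f$ is reconstructible if it is equivalent to all of its reconstructions. $\operatorname{pr}_i^{(n)} \colon A^n \to A$ is the projection $\mathbf{a} \mapsto a_i$, $\mathcal{P}(A)$ is the power set of $A$,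 and $\operatorname{supp}(a_1,\dots,a_n) := \{a_1,\dots,a_n\}$. A function $f \colon A^n \to B$ is determined by $(\operatorname{pr}, \operatorname{supp})$ if there exist a map $f^* \colon A \times \mathcal{P}(A) \to B$ and $i \in [n]$ such that $f(\mathbf{a}) = f^*(\operatorname{pr}_i^{(n)}(\mathbf{a}), \operatorname{supp}(\mathbf{a}))$ for all $\mathbf{a} \in A^n$. -}

module Defs where

open import Level using (Level)
open import Data.Nat.Base using (ℕ; suc; pred)
open import Data.Fin.Base using (Fin; _<_; punchOut)
open import Data.Fin.Properties using (_≟_; <⇒≢)
open import Data.Fin.Permutation using (Permutation′; _⟨$⟩ʳ_)
open import Data.Fin.Subset using (Subset; ⁅_⁆; ⋃)
open import Data.Product.Base using (Σ-syntax; ∃₂; _×_; _,_)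
open import Data.Vec.Base using (Vec; lookup; tabulate; map; toList)
open import Function.Base using (_∘_)
open import Function.Bundles using (_↔_; Inverse)
open import Relation.Binary.Core using (Rel)
open import Relation.Binary.PropositionalEquality.Core using (_≡_; _≢_; sym)
open import Relation.Nullary.Decidable.Core using (yes; no)

private
  variable
    a b c ℓ : Level
    A : Set a
    B : Set b
    k m n : ℕ

AtLeastTwo : Set a → Set a
AtLeastTwo A = ∃₂ λ (x y : A) → x ≢ y

infixl 7 _·_

_·_ : Vec A n → (Fin m → Fin n) → Vec A m
𝐚 · σ = tabulate (λ i → lookup 𝐚 (σ i))

infix 4 _≃_

_≃_ : (f g : Vec A n → B) → Set _
_≃_ {n = n} f g = Σ[ σ ∈ Permutation′ n ] (∀ 𝐚 → f 𝐚 ≡ g (𝐚 · (σ ⟨$⟩ʳ_)))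

-- A two-element subset I of Fin n, encoded as (min I , max I , min I < max I).
-- Proofs of _<_ are unique, so each such subset occurs exactly once.
Pair : ℕ → Set
Pair n = ∃₂ λ (i j : Fin n) → i < j

-- punchOut at j fixes every index below j and lowers every index above j by
-- one.  As i < j, the first clause therefore returns i itself, seen as an
-- element of Fin (pred n).
δ : Pair n → Fin n → Fin (pred n)
δ {n = suc _} (i , j , i<j) l with l ≟ j
... | yes _   = punchOut {i = j} {j = i} (<⇒≢ i<j ∘ sym)
... | no  l≢j = punchOut {i = j} {j = l} (l≢j ∘ sym)

minor : (Vec A n → B) → Pair n → Vec A (pred n) → B
minor f I 𝐚 = f (𝐚 · δ I)

-- Multisets are represented as indexed families; two families over I and J
-- denote the same multiset of ≈-classes when a bijection I ↔ J matches their
-- members up to ≈.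
SameMultiset : {I : Set a} {J : Set b} {X : Set c} → Rel X ℓ → (I → X) → (J → X) → Set _
SameMultiset {I = I} {J = J} _≈_ x y =
  Σ[ φ ∈ I ↔ J ] (∀ i → x i ≈ y (Inverse.to φ i))

deck : (Vec A n → B) → Pair n → (Vec A (pred n) → B)
deck f I = minor f I

IsReconstructionOf : (g f : Vec A n → B) → Set _
IsReconstructionOf g f = SameMultiset _≃_ (deck f) (deck g)

Reconstructible : (Vec A n → B) → Set _
Reconstructible f = ∀ g → IsReconstructionOf g f → f ≃ g

-- For a set A enumerated by e : A ↔ Fin k, the power set 𝒫(A) is represented
-- by Subset k, where S stands for { x | Inverse.to e x ∈ S }.  Subsets with
-- the same elements are then propositionally equal, which would fail for
-- predicates on A.
supp : A ↔ Fin k → Vec A n → Subset k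
supp e 𝐚 = ⋃ (toList (map (⁅_⁆ ∘ Inverse.to e) 𝐚))

DeterminedByPrSupp : A ↔ Fin k → (Vec A n → B) → Set _
DeterminedByPrSupp {A = A} {k = k} {n = n} {B = B} e f =
  Σ[ f* ∈ (A × Subset k → B) ] Σ[ i ∈ Fin n ]
    (∀ 𝐚 → f 𝐚 ≡ f* (lookup 𝐚 i , supp e 𝐚))

{-# OPTIONS --safe #-}
-- Every minor of f is, up to a permutation, (a₁,…) ↦ f*(a₁, supp a).  Hence for
-- each pair I = {i , j} there is an index q_I such that g a = f*(a_{q_I}, supp a)
-- whenever a_i = a_j.  Comparing two pairs I and J on the tuples constant on I
-- and on J, either q_I and q_J lie in the same block of the partition generated
-- by I and J, or f*(x , S) does not depend on x ∈ S at all, since that partition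
-- has at least n - 2 ≥ k blocks and a tuple constant on blocks can take all values
-- of S with prescribed distinct values at q_I and q_J.  As n ≥ 4, the pairs {0,1}
-- and {2,3} yield (unless f* is independent of x) some I with q_I ∉ I.  This
-- q = q_I serves for every pair J: if q ∉ J then q is a block by itself, and if
-- q ∈ J then J is a block of the partition generated by J and a pair disjoint
-- from J, which q already serves.  As n > k, every tuple is constant on some pair.
module Submission where

open import Defs
open import Data.Bool.Base using (Bool)
open import Data.Fin.Base as Fin using (Fin; zero; suc; toℕ; fromℕ<; inject≤; punchIn; punchOut)
open import Data.Fin.Patterns using (0F; 1F; 2F; 3F)
open import Data.Fin.Permutation
  using (Permutation′; _⟨$⟩ʳ_; _⟨$⟩ˡ_; inverseˡ; inverseʳ; transpose; _∘ₚ_)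
open import Data.Fin.Properties
  using (_≟_; <-cmp; <⇒≢; pigeonhole; toℕ<n; fromℕ<-toℕ; fromℕ<-cong; toℕ-inject≤;
         inject≤-injective; punchIn-injective; punchInᵢ≢i; punchIn-punchOut; punchOut-punchIn;
         punchOut-cong)
open import Data.Fin.Subset using (Subset; _∈_)
open import Data.Fin.Subset.Properties
  using (x∈⁅x⁆; x∈⁅y⁆⇒x≡y; x∈p∪q⁻; x∈p∪q⁺; ∉⊥; ⊆-antisym; _∈?_)
open import Data.Nat.Base as ℕ using (ℕ; suc; _+_; _≤_; _≥_; z≤n; s≤s)
open import Data.Nat.Properties as ℕ using (≤-trans; n≤1+n; +-comm)
open import Data.Product.Base using (Σ-syntax; ∃-syntax; ∃₂; _×_; _,_; proj₁; proj₂)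
open import Data.Sum.Base using (_⊎_; inj₁; inj₂; [_,_])
open import Data.Vec.Base using (Vec; []; _∷_; lookup; tabulate)
open import Data.Vec.Properties using (lookup∘tabulate; tabulate∘lookup; tabulate-cong)
open import Function.Base using (_∘_)
open import Function.Bundles using (_↔_; Inverse; Injection)
open import Function.Properties.Inverse using (Inverse⇒Injection)
open import Level using (Level)
open import Relation.Binary.Definitions using (tri<; tri≈; tri>)
open import Relation.Binary.PropositionalEquality
  using (_≡_; _≢_; refl; sym; trans; cong; cong₂; subst; module ≡-Reasoning)
open import Relation.Nullary.Decidable
  using (Dec; yes; no; does; dec-true; dec-false; _⊎-dec_)
open import Relation.Nullary.Negation using (¬_; contradiction)

open ≡-Reasoning

private
  variable
    a b : Level
    A : Set a
    B : Set b
    k m n : ℕ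

↔-injective : ∀ {X : Set a} {Y : Set b} (φ : X ↔ Y) {x y} →
              Inverse.to φ x ≡ Inverse.to φ y → x ≡ y
↔-injective φ = Injection.injective (Inverse⇒Injection φ)

does-≢ : ∀ {P : Set a} {Q : Set b} (P? : Dec P) (Q? : Dec Q) → P → ¬ Q → does P? ≢ does Q?
does-≢ P? Q? p ¬q eq with () ← trans (sym (dec-true P? p)) (trans eq (dec-false Q? ¬q))

does-≡-false : ∀ {P : Set a} {Q : Set b} (P? : Dec P) (Q? : Dec Q) → ¬ P → ¬ Q → does P? ≡ does Q?
does-≡-false P? Q? ¬p ¬q = trans (dec-false P? ¬p) (sym (dec-false Q? ¬q))

lookup-· : (𝐚 : Vec A n) (σ : Fin m → Fin n) (l : Fin m) → lookup (𝐚 · σ) l ≡ lookup 𝐚 (σ l)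
lookup-· 𝐚 σ = lookup∘tabulate (lookup 𝐚 ∘ σ)

-- Identification maps

δ-punchIn : (I : Pair (suc n)) (c : Fin n) → δ I (punchIn (proj₁ (proj₂ I)) c) ≡ c
δ-punchIn (i , j , i<j) c with punchIn j c ≟ j
... | yes eq = contradiction eq (punchInᵢ≢i j c)
... | no  _  = trans (punchOut-cong j refl) (punchOut-punchIn j)

-- Later computations with `δ I` use `punchIn j` as its section and split according to whether the
-- index is the one exceptional point `j`.
punchIn-δ : (I : Pair (suc n)) (l : Fin (suc n)) → let (i , j , _) = I in
            punchIn j (δ I l) ≡ l ⊎ (l ≡ j × punchIn j (δ I l) ≡ i)
punchIn-δ (i , j , i<j) l with l ≟ j
... | yes l≡j = inj₂ (l≡j , punchIn-punchOut _)
... | no  _   = inj₁ (punchIn-punchOut _)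

δ-merges : (I : Pair (suc n)) → let (i , j , _) = I in δ I i ≡ δ I j
δ-merges I@(i , j , i<j) = punchIn-injective j _ _ (trans at-i (sym at-j))
  where
  at-i : punchIn j (δ I i) ≡ i
  at-i with punchIn-δ I i
  ... | inj₁ eq       = eq
  ... | inj₂ (_ , eq) = eq
  at-j : punchIn j (δ I j) ≡ i
  at-j with punchIn-δ I j
  ... | inj₁ eq       = contradiction eq (punchInᵢ≢i j _)
  ... | inj₂ (_ , eq) = eq

-- Relabelling finite sets

transpose-fst : (i j : Fin n) → transpose i j ⟨$⟩ʳ i ≡ j
transpose-fst i j rewrite dec-true (i ≟ i) refl = refl

transpose-other : ∀ {i j l : Fin n} → l ≢ i → l ≢ j → transpose i j ⟨$⟩ʳ l ≡ l
transpose-other {i = i} {j} {l} l≢i l≢j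
  rewrite dec-false (l ≟ i) l≢i | dec-false (l ≟ j) l≢j = refl

-- A first transposition takes `p` to `x`; a second one corrects the image of `q` and leaves `x`
-- alone.
two-transitive : ∀ {p q x y : Fin n} → p ≢ q → x ≢ y →
                 Σ[ π ∈ Permutation′ n ] π ⟨$⟩ʳ p ≡ x × π ⟨$⟩ʳ q ≡ y
two-transitive {p = p} {q} {x} {y} p≢q x≢y =
  τ ∘ₚ transpose q₁ y
  , trans (cong (transpose q₁ y ⟨$⟩ʳ_) (transpose-fst p x)) (transpose-other x≢q₁ x≢y)
  , transpose-fst q₁ y
  where
  τ = transpose p x
  q₁ = τ ⟨$⟩ʳ q
  x≢q₁ : x ≢ q₁
  x≢q₁ eq = p≢q (↔-injective τ (trans (transpose-fst p x) eq))

-- A left inverse of `inject≤`; the default `d` is taken on indices beyond `k`.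
restrict : Fin k → Fin m → Fin k
restrict {k = k} d l with toℕ l ℕ.<? k
... | yes l<k = fromℕ< l<k
... | no  _   = d

restrict-inject≤ : (d : Fin k) (k≤m : k ≤ m) (z : Fin k) → restrict d (inject≤ z k≤m) ≡ z
restrict-inject≤ {k = k} d k≤m z with toℕ (inject≤ z k≤m) ℕ.<? k
... | yes z<k = trans (fromℕ<-cong _ _ (toℕ-inject≤ z k≤m) z<k (toℕ<n z)) (fromℕ<-toℕ z (toℕ<n z))
... | no  z≮k = contradiction (subst (ℕ._< k) (sym (toℕ-inject≤ z k≤m)) (toℕ<n z)) z≮k

-- Partitions with at least m blocks whose blocks do not separate values of T

record Quotient {n : ℕ} (T : Fin n → Bool) (m : ℕ) : Set where
  field
    size    : ℕ
    m≤size  : m ≤ size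
    cls     : Fin n → Fin size
    rep     : Fin size → Fin n
    cls-rep : ∀ c → cls (rep c) ≡ c
    T-rep   : ∀ l → T (rep (cls l)) ≡ T l

  cls⇒T : ∀ {u v} → cls u ≡ cls v → T u ≡ T v
  cls⇒T {u} {v} eq = trans (sym (T-rep u)) (trans (cong (T ∘ rep) eq) (T-rep v))

open Quotient

discrete : (T : Fin n → Bool) → Quotient T n
discrete T = record
  { m≤size = ℕ.≤-refl; cls = λ l → l; rep = λ l → l; cls-rep = λ _ → refl; T-rep = λ _ → refl }

weaken : {T : Fin n → Bool} → k ≤ m → Quotient T m → Quotient T k
weaken k≤m Q = record
  { m≤size = ≤-trans k≤m (m≤size Q)
  ; cls = cls Q; rep = rep Q; cls-rep = cls-rep Q; T-rep = T-rep Q }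

infix 4 _⊑_

_⊑_ : {T : Fin n → Bool} → Quotient T m → Quotient T k → Set
Q ⊑ R = ∀ u v → cls Q u ≡ cls Q v → cls R u ≡ cls R v

-- Applying `δ` to block indices fuses two blocks. The fused block keeps the representative of `i`,
-- so `T i ≡ T j` is what preserves `T` on the former block of `j`.
merge< : {T : Fin n → Bool} (Q : Quotient T (suc m)) (i j : Fin n) → T i ≡ T j →
         cls Q i Fin.< cls Q j → Σ[ R ∈ Quotient T m ] cls R i ≡ cls R j × Q ⊑ R
merge< {T = T} Q@record { size = suc s ; m≤size = s≤s m≤s } i j Tij i<j =
  record
    { m≤size  = m≤s
    ; cls     = δ I ∘ cls Q
    ; rep     = rep Q ∘ punchIn (cls Q j)
    ; cls-rep = λ c → trans (cong (δ I) (cls-rep Q _)) (δ-punchIn I c)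
    ; T-rep   = T-rep′
    }
  , δ-merges I
  , λ _ _ → cong (δ I)
  where
  I : Pair (suc s)
  I = cls Q i , cls Q j , i<j

  T-rep′ : ∀ l → T (rep Q (punchIn (cls Q j) (δ I (cls Q l)))) ≡ T l
  T-rep′ l with punchIn-δ I (cls Q l)
  ... | inj₁ eq         = trans (cong (T ∘ rep Q) eq) (T-rep Q l)
  ... | inj₂ (l~j , eq) = begin
    T (rep Q (punchIn (cls Q j) (δ I (cls Q l)))) ≡⟨ cong (T ∘ rep Q) eq ⟩
    T (rep Q (cls Q i))                           ≡⟨ T-rep Q i ⟩
    T i                                           ≡⟨ Tij ⟩
    T j                                           ≡⟨ cls⇒T Q l~j ⟨
    T l                                           ∎

-- If `i` and `j` already share a block, no block is lost and only the bound drops; hence `Quotient`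
-- records a lower bound for the size.
merge : {T : Fin n → Bool} (Q : Quotient T (suc m)) (i j : Fin n) → T i ≡ T j →
        Σ[ R ∈ Quotient T m ] cls R i ≡ cls R j × Q ⊑ R
merge Q i j Tij with <-cmp (cls Q i) (cls Q j)
... | tri< i<j _ _ = merge< Q i j Tij i<j
... | tri≈ _ i~j _ = weaken (n≤1+n _) Q , i~j , λ _ _ eq → eq
... | tri> _ _ j<i with merge< Q j i (sym Tij) j<i
...   | R , j~i , Q⊑R = R , sym j~i , Q⊑R

-- Two-element subsets

_∈?⁅_,_⁆ : (l i j : Fin n) → Dec (l ≡ i ⊎ l ≡ j)
l ∈?⁅ i , j ⁆ = (l ≟ i) ⊎-dec (l ≟ j)

two-outside : {i j : Fin (4 + n)} → i ≢ j →
              ∃₂ λ u v → u ≢ v × ¬ (u ≡ i ⊎ u ≡ j) × ¬ (v ≡ i ⊎ v ≡ j)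
two-outside {n = n} {i} {j} i≢j =
  w 0F , w 1F , (λ eq → 0F≢1F (punchIn-injective _ _ _ (punchIn-injective i _ _ eq)))
  , outside 0F , outside 1F
  where
  0F≢1F : _≢_ {A = Fin (2 + n)} 0F 1F
  0F≢1F ()
  w : Fin (2 + n) → Fin (4 + n)
  -- The inner map skips the position of `j` among the indices other than `i`; the outer one skips
  -- `i`.
  w = punchIn i ∘ punchIn (punchOut i≢j)
  outside : ∀ c → ¬ (w c ≡ i ⊎ w c ≡ j)
  outside c (inj₁ eq) = punchInᵢ≢i i _ eq
  outside c (inj₂ eq) = punchInᵢ≢i (punchOut i≢j) c
    (punchIn-injective i _ _ (trans eq (sym (punchIn-punchOut i≢j))))

-- Supports

module _ {A : Set a} (e : A ↔ Fin k) where
  open Inverse e using (to)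

  lookup∈supp : (𝐚 : Vec A n) (l : Fin n) → to (lookup 𝐚 l) ∈ supp e 𝐚
  lookup∈supp (x ∷ 𝐚) zero    = x∈p∪q⁺ (inj₁ (x∈⁅x⁆ (to x)))
  lookup∈supp (x ∷ 𝐚) (suc l) = x∈p∪q⁺ (inj₂ (lookup∈supp 𝐚 l))

  ∈supp⇒lookup : (𝐚 : Vec A n) {z : Fin k} → z ∈ supp e 𝐚 → ∃[ l ] z ≡ to (lookup 𝐚 l)
  ∈supp⇒lookup []      z∈ = contradiction z∈ ∉⊥
  ∈supp⇒lookup (x ∷ 𝐚) z∈ with x∈p∪q⁻ _ (supp e 𝐚) z∈
  ... | inj₁ z∈⁅x⁆ = zero , x∈⁅y⁆⇒x≡y (to x) z∈⁅x⁆
  ... | inj₂ z∈𝐚   = let l , eq = ∈supp⇒lookup 𝐚 z∈𝐚 in suc l , eq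

  supp-cong : (𝐚 : Vec A m) (𝐛 : Vec A n) →
              (∀ l → ∃[ r ] lookup 𝐚 l ≡ lookup 𝐛 r) →
              (∀ r → ∃[ l ] lookup 𝐛 r ≡ lookup 𝐚 l) →
              supp e 𝐚 ≡ supp e 𝐛
  supp-cong 𝐚 𝐛 𝐚⊆𝐛 𝐛⊆𝐚 = ⊆-antisym (mono 𝐚 𝐛 𝐚⊆𝐛) (mono 𝐛 𝐚 𝐛⊆𝐚)
    where
    mono : ∀ {m n} (𝐜 : Vec A m) (𝐝 : Vec A n) → (∀ l → ∃[ r ] lookup 𝐜 l ≡ lookup 𝐝 r) →
           ∀ {z} → z ∈ supp e 𝐜 → z ∈ supp e 𝐝
    mono 𝐜 𝐝 𝐜⊆𝐝 z∈𝐜 =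
      let l , z≡ = ∈supp⇒lookup 𝐜 z∈𝐜
          r , eq = 𝐜⊆𝐝 l
      in subst (_∈ supp e 𝐝) (sym (trans z≡ (cong to eq))) (lookup∈supp 𝐝 r)

  supp-· : (𝐚 : Vec A n) (s : Fin m → Fin n) → (∀ r → ∃[ l ] s l ≡ r) → supp e (𝐚 · s) ≡ supp e 𝐚
  supp-· 𝐚 s onto = supp-cong (𝐚 · s) 𝐚
    (λ l → s l , lookup-· 𝐚 s l)
    (λ r → let l , sl≡r = onto r in
           l , trans (cong (lookup 𝐚) (sym sl≡r)) (sym (lookup∘tabulate _ l)))

-- Functions of one entry and the support

module _ {A : Set a} {B : Set b} (e : A ↔ Fin k) (f* : A × Subset k → B) where
  open Inverse e using (to; from; strictlyInverseʳ)

  F : Fin n → Vec A n → B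
  F p 𝐚 = f* (lookup 𝐚 p , supp e 𝐚)

  -- The degenerate case: `f* (x , S)` does not depend on `x ∈ S`, for every `S` that is the support
  -- of an `n`-tuple.
  Constant : ℕ → Set _
  Constant n = ∀ (𝐚 : Vec A n) p q → F p 𝐚 ≡ F q 𝐚

  module _ {T : Fin n → Bool} (Q : Quotient T k) {p q : Fin n} (p≁q : cls Q p ≢ cls Q q) where

    -- With at least `k` blocks, each element of `A` can own a block, and a permutation of the
    -- blocks gives those of `p` and `q` to the two chosen values.
    prescribe : (𝐚 : Vec A n) (p′ q′ : Fin n) → lookup 𝐚 p′ ≢ lookup 𝐚 q′ →
                Σ[ 𝐛 ∈ Vec A n ]
                  (∀ {u v} → cls Q u ≡ cls Q v → lookup 𝐛 u ≡ lookup 𝐛 v) ×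
                  lookup 𝐛 p ≡ lookup 𝐚 p′ × lookup 𝐛 q ≡ lookup 𝐚 q′ × supp e 𝐛 ≡ supp e 𝐚
    prescribe 𝐚 p′ q′ x≢y =
      𝐛 , 𝐛-blocks , at-label p p′ πp , at-label q q′ πq , supp-cong e 𝐛 𝐚 𝐛⊆𝐚 𝐚⊆𝐛
      where
      x = lookup 𝐚 p′
      y = lookup 𝐚 q′
      ι : Fin k → Fin (size Q)
      ι z = inject≤ z (m≤size Q)

      perm = two-transitive p≁q
               (x≢y ∘ ↔-injective e ∘ inject≤-injective (m≤size Q) (m≤size Q) (to x) (to y))
      π = proj₁ perm
      πp = proj₁ (proj₂ perm)
      πq = proj₂ (proj₂ perm)

      -- Blocks in excess of `k` receive the label of `x`, which is in the support anyway.
      label : Fin n → Fin k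
      label l = restrict (to x) (π ⟨$⟩ʳ cls Q l)

      -- Labels outside the support of `𝐚` are replaced by `x`, so that the support does not grow.
      value : Fin k → A
      value z with z ∈? supp e 𝐚
      ... | yes _ = from z
      ... | no  _ = x

      value-to : ∀ l → value (to (lookup 𝐚 l)) ≡ lookup 𝐚 l
      value-to l with to (lookup 𝐚 l) ∈? supp e 𝐚
      ... | yes _  = strictlyInverseʳ _
      ... | no  ∉𝐚 = contradiction (lookup∈supp e 𝐚 l) ∉𝐚

      value-in : ∀ z → ∃[ l ] value z ≡ lookup 𝐚 l
      value-in z with z ∈? supp e 𝐚
      ... | no  _  = p′ , refl
      ... | yes z∈ = let l , z≡ = ∈supp⇒lookup e 𝐚 z∈ in
                     l , trans (cong from z≡) (strictlyInverseʳ _)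

      𝐛 : Vec A n
      𝐛 = tabulate (value ∘ label)

      lookup-𝐛 : ∀ l → lookup 𝐛 l ≡ value (label l)
      lookup-𝐛 = lookup∘tabulate (value ∘ label)

      at-label : ∀ l r → π ⟨$⟩ʳ cls Q l ≡ ι (to (lookup 𝐚 r)) → lookup 𝐛 l ≡ lookup 𝐚 r
      at-label l r eq = begin
        lookup 𝐛 l                                        ≡⟨ lookup-𝐛 l ⟩
        value (label l)                                   ≡⟨ cong (value ∘ restrict (to x)) eq ⟩
        value (restrict (to x) (ι (to (lookup 𝐚 r))))
          ≡⟨ cong value (restrict-inject≤ (to x) (m≤size Q) _) ⟩
        value (to (lookup 𝐚 r))                           ≡⟨ value-to r ⟩
        lookup 𝐚 r                                        ∎

      𝐛-blocks : ∀ {u v} → cls Q u ≡ cls Q v → lookup 𝐛 u ≡ lookup 𝐛 v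
      𝐛-blocks {u} {v} u~v = begin
        lookup 𝐛 u                                  ≡⟨ lookup-𝐛 u ⟩
        value (label u)
          ≡⟨ cong (λ c → value (restrict (to x) (π ⟨$⟩ʳ c))) u~v ⟩
        value (label v)                             ≡⟨ lookup-𝐛 v ⟨
        lookup 𝐛 v                                  ∎

      𝐛⊆𝐚 : ∀ l → ∃[ r ] lookup 𝐛 l ≡ lookup 𝐚 r
      𝐛⊆𝐚 l = let r , eq = value-in (label l) in r , trans (lookup-𝐛 l) eq

      𝐚⊆𝐛 : ∀ r → ∃[ l ] lookup 𝐚 r ≡ lookup 𝐛 l
      𝐚⊆𝐛 r = l , sym (at-label l r (trans (cong (π ⟨$⟩ʳ_) (cls-rep Q _)) (inverseʳ π)))
        where l = rep Q (π ⟨$⟩ˡ ι (to (lookup 𝐚 r)))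

    constant-by-blocks :
      (∀ 𝐚 → (∀ {u v} → cls Q u ≡ cls Q v → lookup 𝐚 u ≡ lookup 𝐚 v) → F p 𝐚 ≡ F q 𝐚) →
      Constant n
    -- Equality in `A` is decided through the enumeration `e`.
    constant-by-blocks Fp≡Fq 𝐚 p′ q′ with to (lookup 𝐚 p′) ≟ to (lookup 𝐚 q′)
    ... | yes eq = cong (λ x → f* (x , supp e 𝐚)) (↔-injective e eq)
    ... | no neq =
      let 𝐛 , blocks , bp , bq , bs = prescribe 𝐚 p′ q′ (neq ∘ cong to) in begin
      F p′ 𝐚 ≡⟨ cong₂ (λ x S → f* (x , S)) bp bs ⟨
      F p 𝐛  ≡⟨ Fp≡Fq 𝐛 blocks ⟩
      F q 𝐛  ≡⟨ cong₂ (λ x S → f* (x , S)) bq bs ⟩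
      F q′ 𝐚 ∎

  -- Two merges of the discrete partition cost at most two blocks, leaving at least `n ≥ k`. The
  -- colouring `T` certifies that `p` and `q` remain in different blocks, so the generated partition
  -- need not be computed.
  separated⇒constant : {n : ℕ} (T : Fin (2 + n) → Bool) → k ≤ n → ∀ i j i′ j′ {p q} →
    T i ≡ T j → T i′ ≡ T j′ → T p ≢ T q →
    (∀ 𝐚 → lookup 𝐚 i ≡ lookup 𝐚 j → lookup 𝐚 i′ ≡ lookup 𝐚 j′ → F p 𝐚 ≡ F q 𝐚) →
    Constant (2 + n)
  separated⇒constant T k≤n i j i′ j′ Tij Ti′j′ Tp≢Tq Fp≡Fq =
    let R , i~j , _      = merge (discrete T) i j Tij
        S , i′~j′ , R⊑S  = merge R i′ j′ Ti′j′
    in constant-by-blocks (weaken k≤n S) (Tp≢Tq ∘ cls⇒T S)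
         λ 𝐚 blocks → Fp≡Fq 𝐚 (blocks (R⊑S i j i~j)) (blocks i′~j′)

  -- Gluing the representations on pairs into a single one

  Represents : (Vec A n → B) → (q i j : Fin n) → Set _
  Represents g q i j = ∀ 𝐚 → lookup 𝐚 i ≡ lookup 𝐚 j → g 𝐚 ≡ F q 𝐚

  module _ {n : ℕ} (k≤2+n : k ≤ 2 + n) (g : Vec A (4 + n) → B)
           (local : ∀ {i j} → i ≢ j → ∃[ q ] Represents g q i j) where

    clash : ∀ (T : Fin (4 + n) → Bool) {i j i′ j′ p q} → T i ≡ T j → T i′ ≡ T j′ → T p ≢ T q →
            Represents g p i j → Represents g q i′ j′ → Constant (4 + n)
    clash T {i} {j} {i′} {j′} Tij Ti′j′ Tp≢Tq p-rep q-rep =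
      separated⇒constant T k≤2+n i j i′ j′ Tij Ti′j′ Tp≢Tq
        λ 𝐚 eq eq′ → trans (sym (p-rep 𝐚 eq)) (q-rep 𝐚 eq′)

    -- The indicator of the second pair is constant on both pairs because they are disjoint, so it
    -- can serve as `T`.
    clash-disjoint : ∀ {i j i′ j′ p q} → ¬ (i ≡ i′ ⊎ i ≡ j′) → ¬ (j ≡ i′ ⊎ j ≡ j′) →
                     does (p ∈?⁅ i′ , j′ ⁆) ≢ does (q ∈?⁅ i′ , j′ ⁆) →
                     Represents g p i j → Represents g q i′ j′ → Constant (4 + n)
    clash-disjoint {i} {j} {i′} {j′} i∉ j∉ = clash (λ l → does (l ∈?⁅ i′ , j′ ⁆))
      (does-≡-false (i ∈?⁅ i′ , j′ ⁆) (j ∈?⁅ i′ , j′ ⁆) i∉ j∉)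
      (trans (dec-true (i′ ∈?⁅ i′ , j′ ⁆) (inj₁ refl))
             (sym (dec-true (j′ ∈?⁅ i′ , j′ ⁆) (inj₂ refl))))

    constant⇒represents : Constant (4 + n) → ∀ {p} q {i j} → Represents g p i j → Represents g q i j
    constant⇒represents const q p-rep 𝐚 eq = trans (p-rep 𝐚 eq) (const 𝐚 _ q)

    constant⇒represents-all : Constant (4 + n) → ∀ q {i j} → i ≢ j → Represents g q i j
    constant⇒represents-all const q i≢j = constant⇒represents const q (proj₂ (local i≢j))

    module _ {q i j : Fin (4 + n)} (q∉ij : ¬ (q ≡ i ⊎ q ≡ j)) (q-rep : Represents g q i j) where

      represents-avoiding : ∀ {i′ j′} → i′ ≢ j′ → ¬ (q ≡ i′ ⊎ q ≡ j′) → Represents g q i′ j′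
      represents-avoiding {i′} {j′} i′≢j′ q∉ with local i′≢j′
      ... | q′ , q′-rep with q′ ≟ q
      ...   | yes refl = q′-rep
      ...   | no q′≢q  = constant⇒represents
        -- As `q` lies in neither pair, it is a block by itself, and its indicator separates it from
        -- `q′`.
        (clash (λ l → does (q ≟ l))
               (does-≡-false (q ≟ i) (q ≟ j) (q∉ij ∘ inj₁) (q∉ij ∘ inj₂))
               (does-≡-false (q ≟ i′) (q ≟ j′) (q∉ ∘ inj₁) (q∉ ∘ inj₂))
               (does-≢ (q ≟ q) (q ≟ q′) refl (q′≢q ∘ sym))
               q-rep q′-rep)
        q q′-rep

      represents-containing : ∀ {i′ j′} → i′ ≢ j′ → q ≡ i′ ⊎ q ≡ j′ → Represents g q i′ j′
      represents-containing {i′} {j′} i′≢j′ q∈ with local i′≢j′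
      ... | q′ , q′-rep with q′ ∈?⁅ i′ , j′ ⁆
      -- Both `q` and `q′` lie in the pair, so on the tuples in question their entries coincide.
      ...   | yes q′∈ = λ 𝐚 eq →
        trans (q′-rep 𝐚 eq) (cong (λ x → f* (x , supp e 𝐚)) (trans (at 𝐚 eq q′∈) (sym (at 𝐚 eq q∈))))
        where
        at : ∀ 𝐚 → lookup 𝐚 i′ ≡ lookup 𝐚 j′ → ∀ {l} → l ≡ i′ ⊎ l ≡ j′ → lookup 𝐚 l ≡ lookup 𝐚 i′
        at 𝐚 eq (inj₁ refl) = refl
        at 𝐚 eq (inj₂ refl) = sym eq
      ...   | no q′∉ =
        -- A pair disjoint from the given one avoids `q`, so `q` already represents `g` there;
        -- comparing the two pairs forces the degenerate case.
        let u , v , u≢v , u∉ , v∉ = two-outside i′≢j′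
            q∉uv = [ (λ q≡u → u∉ (subst (λ l → l ≡ i′ ⊎ l ≡ j′) q≡u q∈))
                   , (λ q≡v → v∉ (subst (λ l → l ≡ i′ ⊎ l ≡ j′) q≡v q∈)) ]
        in constant⇒represents
             (clash-disjoint u∉ v∉ (does-≢ (q ∈?⁅ i′ , j′ ⁆) (q′ ∈?⁅ i′ , j′ ⁆) q∈ q′∉)
                             (represents-avoiding u≢v q∉uv) q′-rep)
             q q′-rep

      represents-all : ∀ {i′ j′} → i′ ≢ j′ → Represents g q i′ j′
      represents-all {i′} {j′} i′≢j′ with q ∈?⁅ i′ , j′ ⁆
      ... | yes q∈ = represents-containing i′≢j′ q∈
      ... | no  q∉ = represents-avoiding i′≢j′ q∉

    global-representative : ∃[ q ] (∀ {i j} → i ≢ j → Represents g q i j)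
    global-representative with local {0F} {1F} (λ ()) | local {2F} {3F} (λ ())
    ... | p , p-rep | q , q-rep with p ∈?⁅ 0F , 1F ⁆ | q ∈?⁅ 2F , 3F ⁆
    ...   | no p∉  | _      = p , represents-all p∉ p-rep
    ...   | yes _  | no q∉  = q , represents-all q∉ q-rep
    ...   | yes p∈ | yes q∈ = p , constant⇒represents-all
      (clash-disjoint {i = 0F} {1F} {2F} {3F} 0∉ 1∉ (separated p∈ q∈) p-rep q-rep) p
      where
      0∉ : ¬ (zero {3 + n} ≡ 2F ⊎ zero {3 + n} ≡ 3F)
      0∉ = [ (λ ()) , (λ ()) ]
      1∉ : ¬ (suc (zero {2 + n}) ≡ 2F ⊎ suc (zero {2 + n}) ≡ 3F)
      1∉ = [ (λ ()) , (λ ()) ]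
      separated : ∀ {p q} → p ≡ 0F ⊎ p ≡ 1F → q ≡ 2F ⊎ q ≡ 3F →
                  does (p ∈?⁅ 2F , 3F ⁆) ≢ does (q ∈?⁅ 2F , 3F ⁆)
      separated {p} {q} p∈ q∈ eq =
        does-≢ (q ∈?⁅ 2F , 3F ⁆) (p ∈?⁅ 2F , 3F ⁆) q∈ (p∉ p∈) (sym eq)
        where
        p∉ : ∀ {p} → p ≡ 0F ⊎ p ≡ 1F → ¬ (p ≡ 2F ⊎ p ≡ 3F)
        p∉ (inj₁ refl) = 0∉
        p∉ (inj₂ refl) = 1∉

-- Minors

·-section : (𝐚 : Vec A (suc n)) (I : Pair (suc n)) → let (i , j , _) = I in
            lookup 𝐚 i ≡ lookup 𝐚 j → (𝐚 · punchIn j) · δ I ≡ 𝐚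
·-section 𝐚 I@(i , j , _) eq = trans (tabulate-cong pointwise) (tabulate∘lookup 𝐚)
  where
  pointwise : ∀ l → lookup (𝐚 · punchIn j) (δ I l) ≡ lookup 𝐚 l
  pointwise l with punchIn-δ I l
  ... | inj₁ eq′          = trans (lookup-· 𝐚 (punchIn j) (δ I l)) (cong (lookup 𝐚) eq′)
  ... | inj₂ (refl , eq′) = trans (lookup-· 𝐚 (punchIn j) (δ I l)) (trans (cong (lookup 𝐚) eq′) eq)

·-inverse : (𝐚 : Vec A n) (σ : Permutation′ n) → (𝐚 · (σ ⟨$⟩ˡ_)) · (σ ⟨$⟩ʳ_) ≡ 𝐚
·-inverse 𝐚 σ = trans
  (tabulate-cong λ l → trans (lookup-· 𝐚 (σ ⟨$⟩ˡ_) (σ ⟨$⟩ʳ l)) (cong (lookup 𝐚) (inverseˡ σ)))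
  (tabulate∘lookup 𝐚)

module _ {A : Set a} {B : Set b} (e : A ↔ Fin k) (f* : A × Subset k → B)
         (f g : Vec A (suc n) → B) (i₀ : Fin (suc n)) (f-det : ∀ 𝐚 → f 𝐚 ≡ F e f* i₀ 𝐚) where

  -- A tuple with equal entries at `i` and `j` comes from an argument of `minor g J`. Passing to
  -- `minor f I` uses only surjective reindexings, which preserve the support.
  minor-representative : (J : Pair (suc n)) → let (i , j , _) = J in
    ∀ I → minor f I ≃ minor g J → ∃[ q ] Represents e f* g q i j
  minor-representative J@(i , j , _) I@(_ , j′ , _) (σ , f≃g) = q , λ 𝐚 eq →
    let 𝐜 = 𝐚 · punchIn j
        𝐝 = 𝐜 · (σ ⟨$⟩ˡ_)
    in begin
    g 𝐚                        ≡⟨ cong g (·-section 𝐚 J eq) ⟨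
    g (𝐜 · δ J)                ≡⟨ cong (minor g J) (·-inverse 𝐜 σ) ⟨
    minor g J (𝐝 · (σ ⟨$⟩ʳ_))  ≡⟨ f≃g 𝐝 ⟨
    f (𝐝 · δ I)                ≡⟨ f-det (𝐝 · δ I) ⟩
    F e f* i₀ (𝐝 · δ I)        ≡⟨ cong₂ (λ x S → f* (x , S)) (value 𝐚) (support 𝐚 eq) ⟩
    F e f* q 𝐚                 ∎
    where
    -- The position in `𝐚` of the entry that `f` reads at `i₀`, traced back through `δ I`, `σ` and
    -- the section of `δ J`.
    q = punchIn j (σ ⟨$⟩ˡ δ I i₀)

    value : ∀ 𝐚 → lookup (((𝐚 · punchIn j) · (σ ⟨$⟩ˡ_)) · δ I) i₀ ≡ lookup 𝐚 q
    value 𝐚 = let 𝐜 = 𝐚 · punchIn j in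
      trans (lookup-· (𝐜 · (σ ⟨$⟩ˡ_)) (δ I) i₀)
      (trans (lookup-· 𝐜 (σ ⟨$⟩ˡ_) (δ I i₀)) (lookup-· 𝐚 (punchIn j) (σ ⟨$⟩ˡ δ I i₀)))

    support : ∀ 𝐚 → lookup 𝐚 i ≡ lookup 𝐚 j →
              supp e (((𝐚 · punchIn j) · (σ ⟨$⟩ˡ_)) · δ I) ≡ supp e 𝐚
    support 𝐚 eq = let 𝐜 = 𝐚 · punchIn j in begin
      supp e ((𝐜 · (σ ⟨$⟩ˡ_)) · δ I)
        ≡⟨ supp-· e (𝐜 · (σ ⟨$⟩ˡ_)) (δ I) (λ c → punchIn j′ c , δ-punchIn I c) ⟩
      supp e (𝐜 · (σ ⟨$⟩ˡ_))         ≡⟨ supp-· e 𝐜 (σ ⟨$⟩ˡ_) (λ c → σ ⟨$⟩ʳ c , inverseˡ σ) ⟩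
      supp e 𝐜                       ≡⟨ supp-· e 𝐜 (δ J) (λ c → punchIn j c , δ-punchIn J c) ⟨
      supp e (𝐜 · δ J)               ≡⟨ cong (supp e) (·-section 𝐚 J eq) ⟩
      supp e 𝐚                       ∎

  pair-representative : IsReconstructionOf g f →
    ∀ J → let (i , j , _) = J in ∃[ q ] Represents e f* g q i j
  pair-representative (φ , f≃g) J = minor-representative J I
    (subst (λ K → minor f I ≃ minor g K) (Inverse.strictlyInverseˡ φ J) (f≃g I))
    where I = Inverse.from φ J

  local-representative : IsReconstructionOf g f →
    ∀ {i j} → i ≢ j → ∃[ q ] Represents e f* g q i j
  local-representative g-rec {i} {j} i≢j with <-cmp i j
  ... | tri< i<j _ _ = pair-representative g-rec (i , j , i<j)
  ... | tri≈ _ i≡j _ = contradiction i≡j i≢j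
  ... | tri> _ _ j<i = let q , q-rep = pair-representative g-rec (j , i , j<i) in
                       q , λ 𝐚 → q-rep 𝐚 ∘ sym

  -- By pigeonhole every tuple repeats a value, so `g` is `F e f* q` everywhere; swapping `q` and
  -- `i₀` turns this into `f`.
  represents-all⇒≃ : suc n ℕ.> k → ∀ {q} →
    (∀ {i j} → i ≢ j → Represents e f* g q i j) → f ≃ g
  represents-all⇒≃ k<n {q} q-rep = transpose q i₀ , λ 𝐚 →
    let σ = transpose q i₀
        i , j , i<j , same = pigeonhole k<n (Inverse.to e ∘ lookup (𝐚 · (σ ⟨$⟩ʳ_)))
    in begin
    f 𝐚                             ≡⟨ f-det 𝐚 ⟩
    F e f* i₀ 𝐚
      ≡⟨ cong₂ (λ x S → f* (x , S))
           (trans (lookup-· 𝐚 (σ ⟨$⟩ʳ_) q) (cong (lookup 𝐚) (transpose-fst q i₀)))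
           (supp-· e 𝐚 (σ ⟨$⟩ʳ_) (λ c → σ ⟨$⟩ˡ c , inverseʳ σ)) ⟨
    F e f* q (𝐚 · (σ ⟨$⟩ʳ_))        ≡⟨ q-rep (<⇒≢ i<j) _ (↔-injective e same) ⟨
    g (𝐚 · (σ ⟨$⟩ʳ_))               ∎

two≤card : AtLeastTwo A → A ↔ Fin k → 2 ≤ k
two≤card {k = 0}           (x , _)       e = contradiction (Inverse.to e x) (λ ())
two≤card {k = 1}           (x , y , x≢y) e = contradiction (↔-injective e (single _ _)) x≢y
  where
  single : (i j : Fin 1) → i ≡ j
  single 0F 0F = refl
two≤card {k = suc (suc _)} _             _ = s≤s (s≤s z≤n)

theorem6p2 : ∀ {a b} {A : Set a} {B : Set b} →
    AtLeastTwo A → AtLeastTwo B →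
    (k n : ℕ) → n ≥ k + 2 →
    (e : A ↔ Fin k) →
    (f : Vec A n → B) → DeterminedByPrSupp e f →
    Reconstructible f
theorem6p2 two _ k n n≥k+2 e f det g g-rec
  -- The first bound, `4 ≤ n`, makes room for two disjoint pairs; the second, `2 + k ≤ n`, leaves
  -- `k` blocks after two merges.
  with ≤-trans (ℕ.+-monoˡ-≤ 2 (two≤card two e)) n≥k+2 | subst (_≤ n) (+-comm k 2) n≥k+2
theorem6p2 two _ k (suc (suc (suc (suc n)))) _ e f (f* , i₀ , f-det) g g-rec
  | s≤s (s≤s (s≤s (s≤s _))) | s≤s (s≤s k≤2+n) =
  let q , q-rep = global-representative e f* k≤2+n g (local-representative e f* f g i₀ f-det g-rec)
  in represents-all⇒≃ e f* f g i₀ f-det (s≤s (≤-trans k≤2+n (n≤1+n _))) q-rep
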